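{- A forest (undirected) is unary FA-presentable if and only if it can be obtained from a unary FA-presentable directed forest by replacing its edge relation with the symmetric closure of that relation.
   Context: An (undirected) forest is regarded as a structure $(T,\eta)$ with $\eta$ a symmetric irreflexive edge relation whose graph has no cycles; a directed forest is a directed graph obtained from a forest by directing each edge. A structure $(X,\eta)$ is unary FA-presentable if there exist a regular language $L\subseteq a^*$ and a surjection $\phi:L\to X$ such that $\{(u,v)\in L^2:u\phi=v\phi\}$ and $\{(u,v)\in L^2:(u\phi,v\phi)\in\eta\}$ are regular relations (the words $\mathrm{conv}(u,v)$ over $\{a,\$\}^2$, reading $u,v$ in parallel with the shorter padded by $\$$, form regular languages). -}

module Defs where

open import Data.Fin.Base using (Fin)
open import Data.Fin.Subset using (Subset; _∈_)
open import Data.List.Base using (List; _∷_; _∷ʳ_; length; foldl; alignWith)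
open import Data.List.Relation.Unary.Linked using (Linked)
open import Data.List.Relation.Unary.Unique.Propositional using (Unique)
open import Data.Maybe.Base using (Maybe)
open import Data.Nat.Base using (ℕ; _≤_)
open import Data.Product.Base using (Σ-syntax; ∃; ∃₂; _×_; _,_)
open import Data.Sum.Base using (_⊎_)
open import Data.These using (fromThis; fromThat)
open import Data.Unit.Base using (⊤)
open import Function.Bundles using (_⇔_)
open import Function.Definitions using (Surjective)
open import Level using (Level; 0ℓ; _⊔_) renaming (suc to lsuc)
open import Relation.Binary.Core using (Rel; _⇒_)
open import Relation.Binary.Definitions using (Symmetric; Irreflexive; Asymmetric)
open import Relation.Binary.PropositionalEquality.Core using (_≡_)
open import Relation.Nullary.Negation.Core using (¬_)
open import Relation.Unary using (Pred; Irrelevant)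

private
  variable
    a ℓ : Level

record DFA (A : Set a) : Set a where
  field
    size  : ℕ
    start : Fin size
    δ     : Fin size → A → Fin size
    final : Subset size

Accepts : {A : Set a} → DFA A → Pred (List A) 0ℓ
Accepts M w = foldl δ start w ∈ final
  where open DFA M

IsRegular : {A : Set a} → Pred (List A) ℓ → Set (a ⊔ ℓ)
IsRegular {A = A} L = Σ[ M ∈ DFA A ] (∀ w → Accepts M w ⇔ L w)

-- The padding symbol $ is `nothing`.
conv : {A : Set a} → List A → List A → List (Maybe A × Maybe A)
conv = alignWith (λ t → fromThis t , fromThat t)

IsRegularRelation : {A : Set a} → Rel (List A) ℓ → Set (a ⊔ ℓ)
IsRegularRelation R = IsRegular (λ w → ∃₂ λ u v → R u v × w ≡ conv u v)

-- The one-letter alphabet {a} is ⊤, so that Word is a*.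
Word : Set
Word = List ⊤

-- The relation {(u , v) ∈ L² : (uφ , vφ) ∈ R} on words.
Preimage : {X : Set a} (L : Pred Word 0ℓ) → (∃ L → X) → Rel X ℓ → Rel Word ℓ
Preimage L φ R u v = Σ[ p ∈ L u ] Σ[ q ∈ L v ] R (φ (u , p)) (φ (v , q))

record UnaryFAPresentable {X : Set a} (η : Rel X ℓ) : Set (lsuc 0ℓ ⊔ a ⊔ ℓ) where
  field
    L            : Pred Word 0ℓ
    -- Makes ∃ L a subset of a*: the value of φ depends on the word only.
    L-irrelevant : Irrelevant L
    L-regular    : IsRegular L
    φ            : ∃ L → X
    φ-surjective : Surjective _≡_ _≡_ φ
    ≡-regular    : IsRegularRelation (Preimage L φ _≡_)
    η-regular    : IsRegularRelation (Preimage L φ η)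

-- The cycle x, x₁, …, xₖ, x, where xs = x₁ ∷ … ∷ xₖ ∷ [].
record IsCycle {X : Set a} (η : Rel X ℓ) (x : X) (xs : List X) : Set (a ⊔ ℓ) where
  field
    long     : 2 ≤ length xs
    distinct : Unique (x ∷ xs)
    closed   : Linked η (x ∷ (xs ∷ʳ x))

record IsForest {X : Set a} (η : Rel X ℓ) : Set (a ⊔ ℓ) where
  field
    symmetric   : Symmetric η
    irreflexive : Irreflexive _≡_ η
    acyclic     : ∀ x xs → ¬ IsCycle η x xs

-- Every edge {x , y} of η is replaced by exactly one of x → y and y → x.
record IsDirectingOf {X : Set a} (ρ η : Rel X ℓ) : Set (a ⊔ ℓ) where
  field
    edge       : ρ ⇒ η
    directed   : ∀ {x y} → η x y → ρ x y ⊎ ρ y x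
    asymmetric : Asymmetric ρ

IsDirectedForest : {X : Set a} → Rel X ℓ → Set (a ⊔ lsuc ℓ)
IsDirectedForest {ℓ = ℓ} {X = X} ρ = Σ[ η ∈ Rel X ℓ ] IsForest η × IsDirectingOf ρ η

{-# OPTIONS --safe #-}
-- Words over a one-letter alphabet are ordered by length, so among the words
-- representing a vertex there is a shortest one.  The subset construction
-- shows that the shortest representatives form a regular language L′, on which
-- φ is injective.  Directing every edge from the vertex with the shorter
-- representative to the one with the longer adds only the condition |u| < |v|
-- to the edge relation on L′, and a word conv u v satisfies it exactly when
-- its first track contains the padding symbol.  Conversely, the symmetric
-- closure of a regular relation is regular, being its union with its flip.
module Submission where

open import Defs
open import Data.Bool.Base using (Bool; true; false; _∨_)
open import Data.Bool.Properties using (_≟_)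
open import Data.Fin.Base using (Fin)
open import Data.Fin.Properties using (any?; *↔×; 2↔Bool; 1↔⊤) renaming (_≟_ to _≟ᶠ_)
open import Data.Fin.Subset using (Subset; _∈_; ⊥)
open import Data.Fin.Subset.Properties using (_∈?_; ∉⊥)
open import Data.List.Base using (List; []; _∷_; length; foldl; map; mapMaybe; catMaybes)
open import Data.List.Properties using (foldl-map; map-∘; map-id)
open import Data.List.Relation.Unary.Any using (Any; here; there)
open import Data.Maybe.Base using (Maybe; just; nothing; maybe′)
open import Data.Nat.Base using (ℕ; _<_; _*_; _^_; s<s; z<s; s<s⁻¹)
open import Data.Nat.Induction using (<-wellFounded)
open import Data.Nat.Properties using (<-cmp; <-asym; n≮0; suc-injective)
open import Data.Product.Base using (Σ-syntax; ∃; _×_; _,_; proj₁; proj₂; swap)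
open import Data.Product.Function.NonDependent.Propositional using (_×-↪_; _×-⇔_)
open import Data.Sum.Base using (_⊎_; inj₁; inj₂; [_,_]′)
open import Data.Sum.Function.Propositional using (_⊎-⇔_)
open import Data.Unit.Base using (⊤; tt)
open import Data.Vec.Base using ([]; _∷_; tabulate)
open import Data.Vec.Properties using (lookup∘tabulate; lookup⇒[]=; []=⇒lookup)
open import Function.Base using (_∘_; flip; case_of_)
open import Function.Bundles using (_⇔_; mk⇔; _↪_; mk↪; Equivalence; RightInverse)
open import Function.Construct.Composition using (_⇔-∘_; _↪-∘_)
open import Function.Construct.Identity using (↪-id)
open import Function.Construct.Symmetry using (↔-sym)
open import Function.Properties.Inverse using (↔⇒↪)
open import Induction.WellFounded using (Acc; acc)
open import Level using (Level; 0ℓ)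
open import Relation.Binary.Core using (Rel)
open import Relation.Binary.Construct.Closure.Symmetric using (SymClosure; fwd; bwd)
open import Relation.Binary.Definitions using (tri<; tri≈; tri>)
open import Relation.Binary.PropositionalEquality.Core using (_≡_; refl; sym; trans; cong; subst; subst₂)
open import Relation.Nullary.Decidable using (yes; no; does; dec-true; _×-dec_; _⊎-dec_; ¬?)
  renaming (map to map-Dec)
open import Relation.Nullary.Negation.Core using (¬_; contradiction)
open import Relation.Unary using (Pred; Decidable; Irrelevant)

open Equivalence using (to; from)

private
  variable
    a b ℓ ℓ₁ : Level
    A B : Set a
    K K₁ K₂ : Pred (List A) ℓ
    R R₁ R₂ : Rel (List A) ℓ

-- Regular languages

∈-tabulate⇔ : ∀ {n} {P : Pred (Fin n) ℓ} (P? : Decidable P) i →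
              i ∈ tabulate (does ∘ P?) ⇔ P i
∈-tabulate⇔ {P = P} P? i = mk⇔ ⇒ ⇐
  where
  ⇒ : i ∈ tabulate (does ∘ P?) → P i
  ⇒ i∈ with P? i | trans (sym (lookup∘tabulate (does ∘ P?) i)) ([]=⇒lookup i∈)
  ... | yes p | _ = p

  ⇐ : P i → i ∈ tabulate (does ∘ P?)
  ⇐ p = lookup⇒[]= i _ (trans (lookup∘tabulate (does ∘ P?) i) (dec-true (P? i) p))

×↪Fin : ∀ {m n} → A ↪ Fin m → B ↪ Fin n → (A × B) ↪ Fin (m * n)
×↪Fin f g = ↔⇒↪ (↔-sym *↔×) ↪-∘ (f ×-↪ g)

Subset↪Fin : ∀ n → Subset n ↪ Fin (2 ^ n)
Subset↪Fin ℕ.zero    = ↔⇒↪ (↔-sym 1↔⊤) ↪-∘ mk↪ {from = λ _ → []} λ { {[]} _ → refl }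
Subset↪Fin (ℕ.suc n) =
  ×↪Fin (↔⇒↪ (↔-sym 2↔Bool)) (Subset↪Fin n)
    ↪-∘ mk↪ {to = λ { (b ∷ p) → b , p }} {from = λ (b , p) → b ∷ p} λ { {_ ∷ _} refl → refl }

-- States may be taken from any type that is a retract of `Fin n`: decoding after encoding is the
-- identity, so codes outside the image never affect a run.
recognised : ∀ {Q : Set} {n} → Q ↪ Fin n → (start : Q) (step : Q → A → Q)
             {P : Pred Q ℓ} → Decidable P → IsRegular (P ∘ foldl step start)
recognised {A = A} {Q = Q} {n} Q↪Fin start step {P} P? = M , accepts
  where
  open RightInverse Q↪Fin using (strictlyInverseʳ) renaming (to to encode; from to decode)

  M : DFA A
  M = record
    { size  = n
    ; start = encode start
    ; δ     = λ i c → encode (step (decode i) c)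
    ; final = tabulate (does ∘ P? ∘ decode)
    }

  run-decode : ∀ i w → decode (foldl (DFA.δ M) i w) ≡ foldl step (decode i) w
  run-decode i []      = refl
  run-decode i (c ∷ w) =
    trans (run-decode _ w) (cong (λ q → foldl step q w) (strictlyInverseʳ _))

  accepts : ∀ w → Accepts M w ⇔ P (foldl step start w)
  accepts w = subst (λ q → Accepts M w ⇔ P q)
    (trans (run-decode _ w) (cong (λ q → foldl step q w) (strictlyInverseʳ start)))
    (∈-tabulate⇔ (P? ∘ decode) _)

accepts? : (M : DFA A) → Decidable (Accepts M)
accepts? M w = _ ∈? DFA.final M

regular-⇔ : (∀ w → K₁ w ⇔ K₂ w) → IsRegular K₁ → IsRegular K₂
regular-⇔ K₁⇔K₂ (M , M⇔K₁) = M , λ w → K₁⇔K₂ w ⇔-∘ M⇔K₁ w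

foldl-× : ∀ {P : Set a} {Q : Set b} (f : P → A → P) (g : Q → A → Q) p q w →
          foldl (λ (p , q) c → f p c , g q c) (p , q) w ≡ (foldl f p w , foldl g q w)
foldl-× f g p q []      = refl
foldl-× f g p q (c ∷ w) = foldl-× f g (f p c) (g q c) w

-- The product automaton with an arbitrary decidable acceptance condition, shared by intersection
-- and union.
×-regular : (M N : DFA A) {P : Fin (DFA.size M) × Fin (DFA.size N) → Set ℓ} → Decidable P →
            IsRegular (λ w → P (foldl (DFA.δ M) (DFA.start M) w , foldl (DFA.δ N) (DFA.start N) w))
×-regular M N {P} P? =
  regular-⇔ (λ w → let e = foldl-× M.δ N.δ M.start N.start w in mk⇔ (subst P e) (subst P (sym e)))
    (recognised (×↪Fin (↪-id _) (↪-id _)) (M.start , N.start) (λ (p , q) c → M.δ p c , N.δ q c) P?)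
  where
  module M = DFA M
  module N = DFA N

∩-regular : IsRegular K₁ → IsRegular K₂ → IsRegular (λ w → K₁ w × K₂ w)
∩-regular (M , M⇔) (N , N⇔) =
  regular-⇔ (λ w → M⇔ w ×-⇔ N⇔ w)
    (×-regular M N λ (p , q) → (p ∈? DFA.final M) ×-dec (q ∈? DFA.final N))

∪-regular : IsRegular K₁ → IsRegular K₂ → IsRegular (λ w → K₁ w ⊎ K₂ w)
∪-regular (M , M⇔) (N , N⇔) =
  regular-⇔ (λ w → M⇔ w ⊎-⇔ N⇔ w)
    (×-regular M N λ (p , q) → (p ∈? DFA.final M) ⊎-dec (q ∈? DFA.final N))

∁-regular : {K : Pred (List A) ℓ} → IsRegular K → IsRegular (λ w → ¬ K w)
∁-regular (M , M⇔K) =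
  regular-⇔ (λ w → mk⇔ (_∘ from (M⇔K w)) (_∘ to (M⇔K w)))
    (recognised (↪-id _) start δ (λ q → ¬? (q ∈? final)))
  where open DFA M

Any-regular : {P : Pred A ℓ} → Decidable P → IsRegular (Any P)
Any-regular {A = A} {P = P} P? =
  regular-⇔ (λ w → mk⇔ (λ e → case ⇒ false w e of λ { (inj₂ p) → p }) (⇐ false w ∘ inj₂))
    (recognised (↔⇒↪ (↔-sym 2↔Bool)) false step (_≟ true))
  where
  step : Bool → A → Bool
  step b c = b ∨ does (P? c)

  ⇒ : ∀ b w → foldl step b w ≡ true → b ≡ true ⊎ Any P w
  ⇒ b     []      e = inj₁ e
  ⇒ true  (c ∷ w) e = inj₁ refl
  ⇒ false (c ∷ w) e with P? c | ⇒ (does (P? c)) w e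
  ... | yes p | _      = inj₂ (here p)
  ... | no _  | inj₂ p = inj₂ (there p)

  ⇐ : ∀ b w → b ≡ true ⊎ Any P w → foldl step b w ≡ true
  ⇐ b     []      (inj₁ e)         = e
  ⇐ true  (c ∷ w) _                = ⇐ true w (inj₁ refl)
  ⇐ false (c ∷ w) (inj₂ (here p))  = ⇐ _ w (inj₁ (dec-true (P? c) p))
  ⇐ false (c ∷ w) (inj₂ (there p)) = ⇐ _ w (inj₂ p)

foldl-mapMaybe : ∀ {Q : Set b} (f : Q → B → Q) (h : A → Maybe B) q w →
                 foldl f q (mapMaybe h w) ≡ foldl (λ q c → maybe′ (f q) q (h c)) q w
foldl-mapMaybe f h q []      = refl
foldl-mapMaybe f h q (c ∷ w) with h c
... | just d  = foldl-mapMaybe f h (f q d) w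
... | nothing = foldl-mapMaybe f h q w

-- The map may erase letters; the automaton stays in its state on an erased letter.
mapMaybe-regular : {K : Pred (List B) ℓ} (h : A → Maybe B) → IsRegular K → IsRegular (K ∘ mapMaybe h)
mapMaybe-regular h (M , M⇔K) =
  record { size = size; start = start; δ = λ q c → maybe′ (δ q) q (h c); final = final } ,
  λ w → subst (λ q → q ∈ final ⇔ _) (foldl-mapMaybe δ h start w) (M⇔K (mapMaybe h w))
  where open DFA M

map-regular : {K : Pred (List B) ℓ} (h : A → B) → IsRegular K → IsRegular (K ∘ map h)
map-regular h (M , M⇔K) =
  record { size = size; start = start; δ = λ q c → δ q (h c); final = final } ,
  λ w → subst (λ q → q ∈ final ⇔ _) (foldl-map δ h start w) (M⇔K (map h w))
  where open DFA M

-- Regular relations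

track₁ track₂ : List (Maybe A × Maybe A) → List A
track₁ = mapMaybe proj₁
track₂ = mapMaybe proj₂

swap-conv : (u v : List A) → map swap (conv u v) ≡ conv v u
swap-conv []      []      = refl
swap-conv []      (c ∷ v) = cong (_ ∷_) (sym (map-∘ v))
swap-conv (c ∷ u) []      = cong (_ ∷_) (sym (map-∘ u))
swap-conv (c ∷ u) (d ∷ v) = cong (_ ∷_) (swap-conv u v)

-- `conv [] v` reduces to a `map` at once, but `conv u []` is stuck on a variable `u`; inductions
-- that run past the end of the second word need this equation.
map-this≡conv : (u : List A) → map (λ c → just c , nothing) u ≡ conv u []
map-this≡conv []      = refl
map-this≡conv (_ ∷ _) = refl

track₁-conv : (u v : List A) → track₁ (conv u v) ≡ u
track₁-conv []      []      = refl
track₁-conv []      (d ∷ v) = track₁-conv [] v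
track₁-conv (c ∷ u) []      = cong (c ∷_) (trans (cong track₁ (map-this≡conv u)) (track₁-conv u []))
track₁-conv (c ∷ u) (d ∷ v) = cong (c ∷_) (track₁-conv u v)

track₂-swap : (w : List (Maybe A × Maybe A)) → track₁ (map swap w) ≡ track₂ w
track₂-swap w = cong catMaybes (sym (map-∘ w))

track₂-conv : (u v : List A) → track₂ (conv u v) ≡ v
track₂-conv u v =
  trans (sym (track₂-swap (conv u v))) (trans (cong track₁ (swap-conv u v)) (track₁-conv v u))

conv-injective : (u v u′ v′ : List A) → conv u v ≡ conv u′ v′ → u ≡ u′ × v ≡ v′
conv-injective u v u′ v′ e =
  trans (sym (track₁-conv u v)) (trans (cong track₁ e) (track₁-conv u′ v′)) ,
  trans (sym (track₂-conv u v)) (trans (cong track₂ e) (track₂-conv u′ v′))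

-- Acceptance only yields some related pair with the same convolution; injectivity of `conv`
-- identifies it with the given pair.
accepts-conv : (R-regular : IsRegularRelation R) →
               ∀ u v → Accepts (proj₁ R-regular) (conv u v) ⇔ R u v
accepts-conv {R = R} (M , M⇔R) u v = mk⇔ ⇒ λ r → from (M⇔R _) (u , v , r , refl)
  where
  ⇒ : Accepts M (conv u v) → R u v
  ⇒ accepted with to (M⇔R _) accepted
  ... | u′ , v′ , r , e with conv-injective u v u′ v′ e
  ... | refl , refl = r

regularRelation-⇔ : (∀ u v → R₁ u v ⇔ R₂ u v) → IsRegularRelation R₁ → IsRegularRelation R₂
regularRelation-⇔ R₁⇔R₂ = regular-⇔ λ w → mk⇔
  (λ (u , v , r , e) → u , v , to (R₁⇔R₂ u v) r , e)
  (λ (u , v , r , e) → u , v , from (R₁⇔R₂ u v) r , e)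

∪-regularRelation : IsRegularRelation R₁ → IsRegularRelation R₂ →
                    IsRegularRelation (λ u v → R₁ u v ⊎ R₂ u v)
∪-regularRelation R₁-reg R₂-reg = regular-⇔ (λ w → mk⇔
  [ (λ (u , v , r , e) → u , v , inj₁ r , e) , (λ (u , v , r , e) → u , v , inj₂ r , e) ]′
  λ { (u , v , inj₁ r , e) → inj₁ (u , v , r , e) ; (u , v , inj₂ r , e) → inj₂ (u , v , r , e) })
  (∪-regular R₁-reg R₂-reg)

flip-regularRelation : IsRegularRelation R → IsRegularRelation (flip R)
flip-regularRelation R-reg = regular-⇔ (λ w → mk⇔
  (λ (u , v , r , e) → v , u , r ,
    -- Swapping the tracks twice gives `w` back.
    trans (sym (trans (sym (map-∘ w)) (map-id w))) (trans (cong (map swap) e) (swap-conv u v)))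
  (λ (u , v , r , e) → v , u , r , trans (cong (map swap) e) (swap-conv u v)))
  (map-regular swap R-reg)

-- Membership of a track in `K` is an inverse image under the map that erases its padding.
restrict-regularRelation : IsRegularRelation R → IsRegular K →
                           IsRegularRelation (λ u v → R u v × K u × K v)
restrict-regularRelation {K = K} R-reg K-reg = regular-⇔ (λ w → mk⇔
  (λ { ((u , v , r , refl) , k₁ , k₂) →
         u , v , (r , subst K (track₁-conv u v) k₁ , subst K (track₂-conv u v) k₂) , refl })
  (λ { (u , v , (r , k₁ , k₂) , refl) →
         (u , v , r , refl) , subst K (sym (track₁-conv u v)) k₁ , subst K (sym (track₂-conv u v)) k₂ }))
  (∩-regular R-reg (∩-regular (mapMaybe-regular proj₁ K-reg) (mapMaybe-regular proj₂ K-reg)))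

padding⇔< : (u v : List A) → Any (λ c → proj₁ c ≡ nothing) (conv u v) ⇔ length u < length v
padding⇔< u v = mk⇔ (⇒ u v) (⇐ u v)
  where
  ⇒ : ∀ u v → Any (λ c → proj₁ c ≡ nothing) (conv u v) → length u < length v
  ⇒ []      (d ∷ v) _         = z<s
  -- Once the second word has ended, padding on the first track would give a length below zero.
  ⇒ (c ∷ u) []      (there p) = contradiction (⇒ u [] (subst (Any _) (map-this≡conv u) p)) n≮0
  ⇒ (c ∷ u) (d ∷ v) (there p) = s<s (⇒ u v p)

  ⇐ : ∀ u v → length u < length v → Any (λ c → proj₁ c ≡ nothing) (conv u v)
  ⇐ []      (d ∷ v) _   = here refl
  ⇐ (c ∷ u) (d ∷ v) u<v = there (⇐ u v (s<s⁻¹ u<v))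

shorter-regularRelation : IsRegularRelation R →
                          IsRegularRelation (λ u v → R u v × length u < length v)
shorter-regularRelation R-reg = regular-⇔ (λ w → mk⇔
  (λ { ((u , v , r , refl) , p) → u , v , (r , to (padding⇔< u v) p) , refl })
  (λ { (u , v , (r , u<v) , refl) → (u , v , r , refl) , from (padding⇔< u v) u<v }))
  (∩-regular R-reg (Any-regular λ { (just _ , _) → no λ () ; (nothing , _) → yes refl }))

-- The subset construction: after reading w the state is the pair of the state
-- of M after conv w w and the set of its states after conv u w for |u| < |w|.
∃shorter-regular : (M : DFA (Maybe ⊤ × Maybe ⊤)) →
                   IsRegular (λ v → ∃ λ u → length u < length v × Accepts M (conv u v))
∃shorter-regular M = regular-⇔ (λ w → mk⇔ (λ s → case ⇒ start ⊥ w s of λ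
    { (inj₁ (_ , p∈⊥ , _)) → contradiction p∈⊥ ∉⊥ ; (inj₂ x) → x }) (⇐ start ⊥ w ∘ inj₂))
  -- No word is shorter than the empty one, so the set of states starts empty.
  (recognised (×↪Fin (↪-id _) (Subset↪Fin size)) (start , ⊥) step final?)
  where
  open DFA M

  Next : Fin size → Subset size → Pred (Fin size) 0ℓ
  -- Either `u` has ended earlier, or it ends just before this letter and its run branches off from
  -- the diagonal state `q`.
  Next q S r = ∃ λ p → (p ∈ S ⊎ p ≡ q) × δ p (nothing , just tt) ≡ r

  next? : ∀ q S → Decidable (Next q S)
  next? q S r = any? λ p → ((p ∈? S) ⊎-dec (p ≟ᶠ q)) ×-dec (δ p (nothing , just tt) ≟ᶠ r)

  next : Fin size → Subset size → Subset size
  next q S = tabulate (does ∘ next? q S)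

  step : Fin size × Subset size → ⊤ → Fin size × Subset size
  step (q , S) _ = δ q (just tt , just tt) , next q S

  Final : Pred (Fin size × Subset size) 0ℓ
  Final (q , S) = ∃ λ p → p ∈ S × p ∈ final

  final? : Decidable Final
  final? (q , S) = any? λ p → (p ∈? S) ×-dec (p ∈? final)

  -- The invariant for an arbitrary state: the first word has ended before `w` is read, or it ends
  -- strictly inside `w`.
  Reaches : Fin size → Subset size → Pred Word 0ℓ
  Reaches q S w = (∃ λ p → p ∈ S × foldl δ p (conv [] w) ∈ final) ⊎
                  (∃ λ u → length u < length w × foldl δ q (conv u w) ∈ final)

  ⇒ : ∀ q S w → Final (foldl step (q , S) w) → Reaches q S w
  ⇒ q S []      f = inj₁ f
  ⇒ q S (_ ∷ w) f with ⇒ _ (next q S) w f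
  ... | inj₂ (u , u<w , accepted) = inj₂ (tt ∷ u , s<s u<w , accepted)
  ... | inj₁ (r , r∈ , accepted) with to (∈-tabulate⇔ (next? q S) r) r∈
  ... | p , inj₁ p∈S  , refl = inj₁ (p , p∈S , accepted)
  ... | p , inj₂ refl , refl = inj₂ ([] , z<s , accepted)

  ⇐ : ∀ q S w → Reaches q S w → Final (foldl step (q , S) w)
  ⇐ q S []      (inj₁ f) = f
  ⇐ q S (_ ∷ w) (inj₁ (p , p∈S , accepted)) =
    ⇐ _ _ w (inj₁ (_ , from (∈-tabulate⇔ (next? q S) _) (p , inj₁ p∈S , refl) , accepted))
  ⇐ q S (_ ∷ w) (inj₂ ([] , _ , accepted)) =
    ⇐ _ _ w (inj₁ (_ , from (∈-tabulate⇔ (next? q S) _) (q , inj₂ refl , refl) , accepted))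
  ⇐ q S (_ ∷ w) (inj₂ (_ ∷ u , u<w , accepted)) =
    ⇐ _ _ w (inj₂ (u , s<s⁻¹ u<w , accepted))

length-injective : {u v : Word} → length u ≡ length v → u ≡ v
length-injective {[]}    {[]}    _ = refl
length-injective {_ ∷ u} {_ ∷ v} e = cong (tt ∷_) (length-injective (suc-injective e))

-- Shortest representatives

module Shortest {a ℓ} {X : Set a} {η : Rel X ℓ} (P : UnaryFAPresentable η) where
  open UnaryFAPresentable P

  -- Accepts, unlike equality in X, lies in Set whatever the level of X, as
  -- the language of a presentation must.
  HasShorter : Pred Word 0ℓ
  HasShorter v = ∃ λ u → length u < length v × Accepts (proj₁ ≡-regular) (conv u v)

  hasShorter-regular : IsRegular HasShorter
  hasShorter-regular = ∃shorter-regular (proj₁ ≡-regular)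

  -- Running the automaton decides this, with no decision procedure for equality in `X`.
  hasShorter? : Decidable HasShorter
  hasShorter? w = map-Dec (proj₂ hasShorter-regular w) (accepts? (proj₁ hasShorter-regular) w)

  L′ : Pred Word 0ℓ
  L′ w = L w × ¬ HasShorter w

  L′-irrelevant : Irrelevant L′
  L′-irrelevant (p , m) (q , m′) = cong (_, m) (L-irrelevant p q)

  φ′ : ∃ L′ → X
  φ′ (w , p , _) = φ (w , p)

  -- Descent on length: a shorter word for the same vertex lies in `L` again, and the search
  -- continues from it.
  shortest : ∀ w (p : L w) → Acc _<_ (length w) → Σ[ s ∈ ∃ L′ ] φ′ s ≡ φ (w , p)
  shortest w p (acc rs) with hasShorter? w
  ... | no m = (w , p , m) , refl
  ... | yes (u , u<w , accepted) with to (accepts-conv ≡-regular u w) accepted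
  ... | q , p′ , φu≡φw with shortest u q (rs u<w)
  ... | s , φ′s≡φu =
    -- The automaton supplies its own proof that `w` is in `L`; irrelevance reconciles it with `p`.
    s , trans φ′s≡φu (trans φu≡φw (cong (λ r → φ (w , r)) (L-irrelevant p′ p)))

  rep : ∀ x → Σ[ s ∈ ∃ L′ ] φ′ s ≡ x
  rep x with φ-surjective x
  ... | (w , p) , φw≡x with shortest w p (<-wellFounded _)
  ... | s , φ′s≡φw = s , trans φ′s≡φw (φw≡x refl)

  rank : X → ℕ
  rank x = length (proj₁ (proj₁ (rep x)))

  -- If one word were shorter, it would witness `HasShorter` for the other. So the lengths agree,
  -- which over one letter means equal words.
  φ′-injective : ∀ s t → φ′ s ≡ φ′ t → proj₁ s ≡ proj₁ t
  φ′-injective (u , p , m) (v , q , n) e with <-cmp (length u) (length v)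
  ... | tri< u<v _ _ = contradiction (u , u<v , from (accepts-conv ≡-regular u v) (p , q , e)) n
  ... | tri≈ _ u≡v _ = length-injective u≡v
  ... | tri> _ _ v<u = contradiction (v , v<u , from (accepts-conv ≡-regular v u) (q , p , sym e)) m

  -- By injectivity `rep` can only return the given word. Comparing ranks thus becomes comparing
  -- lengths, which an automaton can do.
  rank-φ′ : ∀ s → rank (φ′ s) ≡ length (proj₁ s)
  rank-φ′ s = cong length (φ′-injective (proj₁ (rep (φ′ s))) s (proj₂ (rep (φ′ s))))

  φ′-cong : ∀ s t → proj₁ s ≡ proj₁ t → φ′ s ≡ φ′ t
  φ′-cong (w , p , _) (.w , q , _) refl = cong (λ r → φ (w , r)) (L-irrelevant p q)

  -- Equal lengths force equal representatives. With irreflexivity, no edge joins vertices of the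
  -- same rank.
  rank-injective : ∀ x y → rank x ≡ rank y → x ≡ y
  rank-injective x y e = trans (sym (proj₂ (rep x)))
    (trans (φ′-cong (proj₁ (rep x)) (proj₁ (rep y)) (length-injective e)) (proj₂ (rep y)))

  ¬hasShorter-regular : IsRegular (λ w → ¬ HasShorter w)
  ¬hasShorter-regular = ∁-regular hasShorter-regular

  -- Stated for any `R` so as to serve both equality and `η`.
  preimage-regular : (R : Rel X ℓ₁) → IsRegularRelation (Preimage L φ R) →
                     IsRegularRelation (Preimage L′ φ′ R)
  preimage-regular R R-reg = regularRelation-⇔ (λ u v → mk⇔
    (λ ((p , q , r) , m , n) → (p , m) , (q , n) , r)
    (λ ((p , m) , (q , n) , r) → (p , q , r) , m , n))
    (restrict-regularRelation R-reg ¬hasShorter-regular)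

  -- Directing the edges by rank

  ρ : Rel X ℓ
  ρ x y = η x y × rank x < rank y

  ρ-presentable : UnaryFAPresentable ρ
  ρ-presentable = record
    { L            = L′
    ; L-irrelevant = L′-irrelevant
    ; L-regular    = ∩-regular L-regular ¬hasShorter-regular
    ; φ            = φ′
    ; φ-surjective = λ x → proj₁ (rep x) , λ { refl → proj₂ (rep x) }
    ; ≡-regular    = preimage-regular _≡_ ≡-regular
    ; η-regular    = regularRelation-⇔ (λ u v → mk⇔
        (λ ((p , q , e) , u<v) →
          p , q , e , subst₂ _<_ (sym (rank-φ′ (u , p))) (sym (rank-φ′ (v , q))) u<v)
        (λ (p , q , e , lt) →
          (p , q , e) , subst₂ _<_ (rank-φ′ (u , p)) (rank-φ′ (v , q)) lt))
        (shorter-regularRelation (preimage-regular η η-regular))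
    }

  module _ (η-forest : IsForest η) where
    open IsForest η-forest

    ρ-directed : ∀ {x y} → η x y → ρ x y ⊎ ρ y x
    ρ-directed {x} {y} e with <-cmp (rank x) (rank y)
    ... | tri< x<y _ _ = inj₁ (e , x<y)
    ... | tri≈ _ x≡y _ = contradiction e (irreflexive (rank-injective x y x≡y))
    ... | tri> _ _ y<x = inj₂ (symmetric e , y<x)

    ρ-directing : IsDirectingOf ρ η
    ρ-directing = record
      { edge       = proj₁
      ; directed   = ρ-directed
      ; asymmetric = λ (_ , x<y) (_ , y<x) → <-asym x<y y<x
      }

    η⇔SymClosure-ρ : ∀ x y → η x y ⇔ SymClosure ρ x y
    η⇔SymClosure-ρ x y = mk⇔
      ([ fwd , bwd ]′ ∘ ρ-directed)
      λ { (fwd (e , _)) → e ; (bwd (e , _)) → symmetric e }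

-- Symmetric closures

symClosure-presentable : {X : Set a} {ρ η : Rel X ℓ} → UnaryFAPresentable ρ →
                         (∀ x y → η x y ⇔ SymClosure ρ x y) → UnaryFAPresentable η
symClosure-presentable P η⇔ρ = record
  { L            = L
  ; L-irrelevant = L-irrelevant
  ; L-regular    = L-regular
  ; φ            = φ
  ; φ-surjective = φ-surjective
  ; ≡-regular    = ≡-regular
  ; η-regular    = regularRelation-⇔ (λ u v → mk⇔
      [ (λ (p , q , r) → p , q , from (η⇔ρ _ _) (fwd r))
      -- A backward edge lies in the flipped preimage, so the two membership proofs change places.
      , (λ (q , p , r) → p , q , from (η⇔ρ _ _) (bwd r)) ]′
      λ (p , q , e) → case to (η⇔ρ _ _) e of λ
        { (fwd r) → inj₁ (p , q , r) ; (bwd r) → inj₂ (q , p , r) })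
      (∪-regularRelation η-regular (flip-regularRelation η-regular))
  }
  where open UnaryFAPresentable P

theorem6p13 : ∀ {a ℓ : Level} {X : Set a} (η : Rel X ℓ) → IsForest η →
    UnaryFAPresentable η ⇔
    (Σ[ ρ ∈ Rel X ℓ ] IsDirectedForest ρ × UnaryFAPresentable ρ × (∀ x y → η x y ⇔ SymClosure ρ x y))
theorem6p13 η η-forest = mk⇔
  (λ P → let open Shortest P in
    -- The forest whose edges `ρ` directs is `η` itself.
    ρ , (η , η-forest , ρ-directing η-forest) , ρ-presentable , η⇔SymClosure-ρ η-forest)
  (λ (ρ , _ , P , η⇔ρ) → symClosure-presentable P η⇔ρ)
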